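{- Let $\Theta$ be a basic predicate signature with set of constants $C$, let $\bar C$ be an infinite denumerable set of new constants, and let $\Gamma$ be a Hintikka set for $\mathbf{Tm}^*$ in the universe $C\cup\bar C$. Then there exist a four-valued modal structure $\mathfrak A=\langle U,\cdot^{\mathfrak A}\rangle$ over $\Theta(\bar C)$ with $(C\cup\bar C)^{\mathfrak A}=U$ and a $\mathbf{Tm}^*$-valuation $\bar v$ over $\mathfrak A$ such that $\bar v(\varphi)=\mathsf L$ for every signed formula $\mathsf L{:}\varphi\in\Gamma$.
   Context: Syntax: $\Theta$ has predicate symbols of arity $\ge1$ and constants $C$, no function symbols, no equality; $\Theta(\bar C)$ adds the constants $\bar C$. Formulas: atomic $P\tau_1\ldots\tau_n$ ($\tau_i$ variables or constants), $\neg\varphi$, $\Box\varphi$, $\forall x\varphi$, $\varphi\to\psi$; $\exists x\varphi$ abbreviates $\neg\forall x\neg\varphi$. For a formula $\varphi$ with at most $x$ free, $\varphi(c)$ denotes $\varphi[x/c]$. Variants $\varphi\sim\psi$: obtained from one another by adding/deleting void quantifiers or renaming bound variables (keeping free variables in place). A signed formula is $\mathsf L{:}\varphi$ with $\mathsf L\in\{\mathsf T,\mathsf t,\mathsf f,\mathsf F\}$ and $\varphi$ a closed formula over $\Theta(\bar C)$. Semantics: $\tilde\neg$: $\mathsf T\mapsto\{\mathsf F\},\mathsf t\mapsto\{\mathsf f\},\mathsf f\mapsto\{\mathsf t\},\mathsf F\mapsto\{\mathsf T\}$; write $\neg\mathsf L$ for the unique element of $\tilde\neg\mathsf L$. $a\tilde\to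 b$ (rows $a$, columns $b$ in order $\mathsf T,\mathsf t,\mathsf f,\mathsf F$): row $\mathsf T$: $\{\mathsf T\},\{\mathsf t\},\{\mathsf f\},\{\mathsf F\}$; row $\mathsf t$: $\{\mathsf T\},\{\mathsf T,\mathsf t\},\{\mathsf f\},\{\mathsf f\}$; row $\mathsf f$: $\{\mathsf T\},\{\mathsf T,\mathsf t\},\{\mathsf T,\mathsf t\},\{\mathsf t\}$; row $\mathsf F$: all $\{\mathsf T\}$. $\tilde\Box_1\mathsf T=\{\mathsf T,\mathsf t\}$, $\tilde\Box_1a=\{\mathsf f,\mathsf F\}$ for $a\neq\mathsf T$. $\tilde\forall^d_4(X)=\{\min X\}$, order $\mathsf F<\mathsf f<\mathsf t<\mathsf T$. A four-valued modal structure over $\Theta(\bar C)$: $\mathfrak A=\langle U,\cdot^{\mathfrak A}\rangle$, $U\ne\emptyset$, $P^{\mathfrak A}:U^n\to\{\mathsf T,\mathsf t,\mathsf f,\mathsf F\}$ for $n$-ary $P$, $c^{\mathfrak A}\in U$ for constants. When every element of $U$ is denoted by a constant, a $\mathbf{Tm}^*$-valuation over $\mathfrak A$ is a map $v$ from closed formulas over $\Theta(\bar C)$ to $\{\mathsf T,\mathsf t,\mathsf f,\mathsf F\}$ with: $v(Pc_1\ldots c_n)=P^{\mathfrak A}(c_1^{\mathfrak A},\ldots,c_n^{\mathfrak A})$; $v(\neg\varphi)\in\tilde\neg v(\varphi)$; $v(\Box\varphi)\in\tilde\Box_1 v(\varphi)$; $v(\varphi\to\psi)\in v(\varphi)\tilde\to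 v(\psi)$; $v(\forall x\varphi)\in\tilde\forall^d_4(\{v(\varphi[x/c]):c\in C\cup\bar C\})$; $v(\varphi)=v(\varphi')$ if $\varphi\sim\varphi'$. Hintikka set: a set $\Gamma$ of signed formulas over $\Theta(\bar C)$ such that: (1) if $\mathsf L{:}\varphi,\mathsf L'{:}\varphi'\in\Gamma$ and $\varphi\sim\varphi'$ then $\mathsf L=\mathsf L'$; (2) if $\mathsf L{:}\neg\varphi\in\Gamma$ then $\neg\mathsf L{:}\varphi\in\Gamma$; (3) if $\mathsf T{:}\Box\varphi$ or $\mathsf t{:}\Box\varphi$ is in $\Gamma$ then $\mathsf T{:}\varphi\in\Gamma$; (4) if $\mathsf F{:}\Box\varphi$ or $\mathsf f{:}\Box\varphi$ is in $\Gamma$ then $\mathsf L{:}\varphi\in\Gamma$ for a unique $\mathsf L\in\{\mathsf t,\mathsf f,\mathsf F\}$; (5) if $\mathsf T{:}(\varphi\to\psi)\in\Gamma$ then either $\mathsf F{:}\varphi\in\Gamma$, or $\mathsf T{:}\psi\in\Gamma$, or $\mathsf t{:}\varphi,\mathsf t{:}\psi\in\Gamma$, or $\mathsf f{:}\varphi,\mathsf t{:}\psi\in\Gamma$, or $\mathsf f{:}\varphi,\mathsf f{:}\psi\in\Gamma$; (6) if $\mathsf t{:}(\varphi\to\psi)\in\Gamma$ then one of the pairs $\{\mathsf T{:}\varphi,\mathsf t{:}\psi\}$, $\{\mathsf t{:}\varphi,\mathsf t{:}\psi\}$, $\{\mathsf f{:}\varphi,\mathsf t{:}\psi\}$, $\{\mathsf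 f{:}\varphi,\mathsf f{:}\psi\}$ is included in $\Gamma$; (7) if $\mathsf f{:}(\varphi\to\psi)\in\Gamma$ then one of $\{\mathsf T{:}\varphi,\mathsf f{:}\psi\}$, $\{\mathsf t{:}\varphi,\mathsf f{:}\psi\}$, $\{\mathsf t{:}\varphi,\mathsf F{:}\psi\}$ is included in $\Gamma$; (8) if $\mathsf F{:}(\varphi\to\psi)\in\Gamma$ then $\mathsf T{:}\varphi,\mathsf F{:}\psi\in\Gamma$; (9) if $\mathsf T{:}\forall x\varphi\in\Gamma$ then $\mathsf T{:}\varphi(c)\in\Gamma$ for every $c\in C\cup\bar C$; (10) if $\mathsf t{:}\forall x\varphi\in\Gamma$ then $\mathsf t{:}\varphi(c)\in\Gamma$ for some $c\in C\cup\bar C$ and for every $c'\in(C\cup\bar C)\setminus\{c\}$ either $\mathsf T{:}\varphi(c')\in\Gamma$ or $\mathsf t{:}\varphi(c')\in\Gamma$; (11) if $\mathsf f{:}\forall x\varphi\in\Gamma$ then $\mathsf f{:}\varphi(c)\in\Gamma$ for some $c\in C\cup\bar C$ and for every $c'\in(C\cup\bar C)\setminus\{c\}$, one of $\mathsf T{:}\varphi(c')$, $\mathsf t{:}\varphi(c')$, $\mathsf f{:}\varphi(c')$ belongs to $\Gamma$ and $\mathsf F{:}\varphi(c')\notin\Gamma$; (12) if $\mathsf F{:}\forall x\varphi\in\Gamma$ then $\mathsf F{:}\varphi(c)\in\Gamma$ for some $c\in C\cup\bar C$. -}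

module Defs where

open import Level using (0ℓ)
open import Data.Nat using (ℕ; _≤_; NonZero; _≟_)
open import Data.Product using (∃; ∃!; _×_; _,_)
open import Data.Sum using (_⊎_; inj₁; inj₂; [_,_])
open import Data.Vec using (Vec; []; _∷_; map)
open import Data.Vec.Relation.Unary.Any using (here; there)
open import Data.Vec.Membership.Propositional using () renaming (_∈_ to _∈ᵥ_)
open import Relation.Nullary using (¬_; yes; no)
open import Relation.Unary using (Pred; _∈_; _∉_; _∪_; ｛_｝)
open import Relation.Binary.PropositionalEquality using (_≡_; _≢_; refl; sym)

------------------------------------------------------------------------
-- Syntax

record Signature : Set₁ where
  field
    Predicate     : Set
    arity         : Predicate → ℕ
    arity-nonZero : ∀ P → NonZero (arity P)
    Constant      : Set

open Signature public

-- Θ(C̄): the disjoint sum makes the elements of C̄ new.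
_⟨_⟩ : Signature → Set → Signature
Θ ⟨ C̄ ⟩ = record
  { Predicate     = Predicate Θ
  ; arity         = arity Θ
  ; arity-nonZero = arity-nonZero Θ
  ; Constant      = Constant Θ ⊎ C̄
  }

Variable : Set
Variable = ℕ

data Term (Θ : Signature) : Set where
  var : Variable → Term Θ
  con : Constant Θ → Term Θ

infixr 20 _⇒_
infix  25 ¬′_ □_

data Formula (Θ : Signature) : Set where
  atom : (P : Predicate Θ) → Vec (Term Θ) (arity Θ P) → Formula Θ
  ¬′_  : Formula Θ → Formula Θ
  □_   : Formula Θ → Formula Θ
  _⇒_  : Formula Θ → Formula Θ → Formula Θ
  ∀′   : Variable → Formula Θ → Formula Θ

module _ {Θ : Signature} where

  infix 4 _∈FV_ _OccursIn_

  _∈FV_ : Variable → Formula Θ → Set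
  x ∈FV atom P τs = var x ∈ᵥ τs
  x ∈FV ¬′ φ      = x ∈FV φ
  x ∈FV □ φ       = x ∈FV φ
  x ∈FV (φ ⇒ ψ)   = x ∈FV φ ⊎ x ∈FV ψ
  x ∈FV ∀′ y φ    = x ≢ y × x ∈FV φ

  -- Occurrence of any kind: free, bound, or in a quantifier prefix.
  _OccursIn_ : Variable → Formula Θ → Set
  x OccursIn atom P τs = var x ∈ᵥ τs
  x OccursIn ¬′ φ      = x OccursIn φ
  x OccursIn □ φ       = x OccursIn φ
  x OccursIn (φ ⇒ ψ)   = x OccursIn φ ⊎ x OccursIn ψ
  x OccursIn ∀′ y φ    = x ≡ y ⊎ x OccursIn φ

  Closed : Formula Θ → Set
  Closed φ = ∀ x → ¬ (x ∈FV φ)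

  infix 30 _[_/_]ₜ _[_/_]

  _[_/_]ₜ : Term Θ → Variable → Term Θ → Term Θ
  con c [ x / τ ]ₜ = con c
  var y [ x / τ ]ₜ with x ≟ y
  ... | yes _ = τ
  ... | no  _ = var y

  -- φ [ x / τ ] replaces the free occurrences of x by τ.  It does not rename
  -- bound variables: it is only used where τ is a constant or a variable not
  -- occurring in φ, so that no capture can arise.
  _[_/_] : Formula Θ → Variable → Term Θ → Formula Θ
  atom P τs [ x / τ ] = atom P (map (_[ x / τ ]ₜ) τs)
  (¬′ φ)    [ x / τ ] = ¬′ (φ [ x / τ ])
  (□ φ)     [ x / τ ] = □ (φ [ x / τ ])
  (φ ⇒ ψ)   [ x / τ ] = (φ [ x / τ ]) ⇒ (ψ [ x / τ ])
  (∀′ y φ)  [ x / τ ] with x ≟ y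
  ... | yes _ = ∀′ y φ
  ... | no  _ = ∀′ y (φ [ x / τ ])

  infix 4 _∼_

  -- Variants: the least congruence allowing void quantifiers to be added or
  -- deleted and bound variables to be renamed.  Requiring y to be entirely
  -- fresh for φ in `rename` loses nothing: other legitimate renamings are
  -- obtained in two steps through a fresh variable.
  data _∼_ : Formula Θ → Formula Θ → Set where
    ∼-refl  : ∀ {φ} → φ ∼ φ
    ∼-sym   : ∀ {φ ψ} → φ ∼ ψ → ψ ∼ φ
    ∼-trans : ∀ {φ ψ χ} → φ ∼ ψ → ψ ∼ χ → φ ∼ χ
    ¬-cong  : ∀ {φ φ′} → φ ∼ φ′ → ¬′ φ ∼ ¬′ φ′
    □-cong  : ∀ {φ φ′} → φ ∼ φ′ → □ φ ∼ □ φ′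
    ⇒-cong  : ∀ {φ φ′ ψ ψ′} → φ ∼ φ′ → ψ ∼ ψ′ → (φ ⇒ ψ) ∼ (φ′ ⇒ ψ′)
    ∀-cong  : ∀ {x φ φ′} → φ ∼ φ′ → ∀′ x φ ∼ ∀′ x φ′
    void    : ∀ {x φ} → ¬ (x ∈FV φ) → ∀′ x φ ∼ φ
    rename  : ∀ {x y φ} → ¬ (y OccursIn φ) → ∀′ x φ ∼ ∀′ y (φ [ x / var y ])

  private
    ∈-substₜ : ∀ {n} (τs : Vec (Term Θ) n) {x y c} →
               var y ∈ᵥ map (_[ x / con c ]ₜ) τs → y ≢ x × var y ∈ᵥ τs
    ∈-substₜ (con d ∷ τs) (here ())
    ∈-substₜ (con d ∷ τs) (there p) =
      let q , r = ∈-substₜ τs p in q , there r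
    ∈-substₜ (var z ∷ τs) {x} p with x ≟ z
    ∈-substₜ (var z ∷ τs) (here ()) | yes _
    ∈-substₜ (var z ∷ τs) (here refl) | no x≢z =
      (λ z≡x → x≢z (sym z≡x)) , here refl
    ∈-substₜ (var z ∷ τs) (there p) | yes _ =
      let q , r = ∈-substₜ τs p in q , there r
    ∈-substₜ (var z ∷ τs) (there p) | no _ =
      let q , r = ∈-substₜ τs p in q , there r

  ∈FV-subst : ∀ φ {x y c} → y ∈FV φ [ x / con c ] → y ≢ x × y ∈FV φ
  ∈FV-subst (atom P τs) p = ∈-substₜ τs p
  ∈FV-subst (¬′ φ) p = ∈FV-subst φ p
  ∈FV-subst (□ φ) p = ∈FV-subst φ p
  ∈FV-subst (φ ⇒ ψ) (inj₁ p) = let q , r = ∈FV-subst φ p in q , inj₁ r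
  ∈FV-subst (φ ⇒ ψ) (inj₂ p) = let q , r = ∈FV-subst ψ p in q , inj₂ r
  ∈FV-subst (∀′ z φ) {x} p with x ≟ z
  ∈FV-subst (∀′ z φ) (y≢z , p) | yes refl = y≢z , y≢z , p
  ∈FV-subst (∀′ z φ) (y≢z , p) | no _     = let q , r = ∈FV-subst φ p in q , y≢z , r

  closed-instance : ∀ x φ → Closed (∀′ x φ) → ∀ c → Closed (φ [ x / con c ])
  closed-instance x φ cl c y p = cl y (∈FV-subst φ p)

-- The closedness proof is irrelevant, so a sentence is determined by its
-- formula, and a set of sentences is simply a set of closed formulas.
record Sentence (Θ : Signature) : Set where
  constructor sentence
  field
    formula : Formula Θ
    .closed : Closed formula

open Sentence public using (formula)

module _ {Θ : Signature} where

  atomₛ : (P : Predicate Θ) → Vec (Constant Θ) (arity Θ P) → Sentence Θ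
  atomₛ P cs = sentence (atom P (map con cs)) λ _ → no-var cs
    where
    no-var : ∀ {n x} (cs : Vec (Constant Θ) n) → ¬ (var x ∈ᵥ map (con {Θ}) cs)
    no-var (c ∷ cs) (here ())
    no-var (c ∷ cs) (there p) = no-var cs p

  infixr 20 _⇒ₛ_
  infix  25 ¬ₛ_ □ₛ_

  ¬ₛ_ : Sentence Θ → Sentence Θ
  ¬ₛ (sentence φ p) = sentence (¬′ φ) p

  □ₛ_ : Sentence Θ → Sentence Θ
  □ₛ (sentence φ p) = sentence (□ φ) p

  _⇒ₛ_ : Sentence Θ → Sentence Θ → Sentence Θ
  sentence φ p ⇒ₛ sentence ψ q = sentence (φ ⇒ ψ) λ x → [ p x , q x ]

-- A formula φ with at most the variable x free.
record Matrix (Θ : Signature) : Set where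
  constructor matrix
  field
    variable-of : Variable
    body        : Formula Θ
    .closed     : Closed (∀′ variable-of body)

module _ {Θ : Signature} where

  ∀ₛ : Matrix Θ → Sentence Θ
  ∀ₛ (matrix x φ p) = sentence (∀′ x φ) p

  infix 30 _⦅_⦆

  _⦅_⦆ : Matrix Θ → Constant Θ → Sentence Θ
  (matrix x φ p) ⦅ c ⦆ = sentence (φ [ x / con c ]) (closed-instance x φ p c)

------------------------------------------------------------------------
-- Truth values and multioperations

data Value : Set where
  T t f F : Value

rank : Value → ℕ
rank F = 0
rank f = 1
rank t = 2
rank T = 3

infix 4 _≤ᵥ_

_≤ᵥ_ : Value → Value → Set
a ≤ᵥ b = rank a ≤ rank b

neg : Value → Value
neg T = F
neg t = f
neg f = t
neg F = T

¬̃ : Value → Pred Value 0ℓ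
¬̃ a = ｛ neg a ｝

□̃₁ : Value → Pred Value 0ℓ
□̃₁ T = ｛ T ｝ ∪ ｛ t ｝
□̃₁ t = ｛ f ｝ ∪ ｛ F ｝
□̃₁ f = ｛ f ｝ ∪ ｛ F ｝
□̃₁ F = ｛ f ｝ ∪ ｛ F ｝

infix 20 _⇒̃_

_⇒̃_ : Value → Value → Pred Value 0ℓ
T ⇒̃ T = ｛ T ｝
T ⇒̃ t = ｛ t ｝
T ⇒̃ f = ｛ f ｝
T ⇒̃ F = ｛ F ｝
t ⇒̃ T = ｛ T ｝
t ⇒̃ t = ｛ T ｝ ∪ ｛ t ｝
t ⇒̃ f = ｛ f ｝
t ⇒̃ F = ｛ f ｝
f ⇒̃ T = ｛ T ｝
f ⇒̃ t = ｛ T ｝ ∪ ｛ t ｝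
f ⇒̃ f = ｛ T ｝ ∪ ｛ t ｝
f ⇒̃ F = ｛ t ｝
F ⇒̃ T = ｛ T ｝
F ⇒̃ t = ｛ T ｝
F ⇒̃ f = ｛ T ｝
F ⇒̃ F = ｛ T ｝

-- ∀̃ᵈ₄ X = { min X }, the minimum being characterised by its defining property.
∀̃ᵈ₄ : Pred Value 0ℓ → Pred Value 0ℓ
∀̃ᵈ₄ X a = a ∈ X × (∀ b → b ∈ X → a ≤ᵥ b)

------------------------------------------------------------------------
-- Structures and valuations

record Structure (Θ : Signature) : Set₁ where
  field
    U          : Set
    inhabitant : U
    predᴬ      : (P : Predicate Θ) → Vec U (arity Θ P) → Value
    conᴬ       : Constant Θ → U

record IsTm*Valuation {Θ : Signature} (𝔄 : Structure Θ)
                      (v : Sentence Θ → Value) : Set where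
  open Structure 𝔄
  field
    v-atom : ∀ P cs → v (atomₛ P cs) ≡ predᴬ P (map conᴬ cs)
    v-¬    : ∀ φ → v (¬ₛ φ) ∈ ¬̃ (v φ)
    v-□    : ∀ φ → v (□ₛ φ) ∈ □̃₁ (v φ)
    v-⇒    : ∀ φ ψ → v (φ ⇒ₛ ψ) ∈ v φ ⇒̃ v ψ
    v-∀    : ∀ (φ : Matrix Θ) → v (∀ₛ φ) ∈ ∀̃ᵈ₄ (λ a → ∃ λ c → v (φ ⦅ c ⦆) ≡ a)
    v-∼    : ∀ φ φ′ → formula φ ∼ formula φ′ → v φ ≡ v φ′

------------------------------------------------------------------------
-- Hintikka sets

infix 10 _⦂_

record SignedFormula (Θ : Signature) : Set where
  constructor _⦂_
  field
    label     : Value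
    sentenceₛ : Sentence Θ

record HintikkaSet {Θ : Signature} (Γ : Pred (SignedFormula Θ) 0ℓ) : Set where
  field
    variants : ∀ {L L′ φ φ′} → (L ⦂ φ) ∈ Γ → (L′ ⦂ φ′) ∈ Γ →
               formula φ ∼ formula φ′ → L ≡ L′

    neg-L : ∀ {L φ} → (L ⦂ ¬ₛ φ) ∈ Γ → (neg L ⦂ φ) ∈ Γ

    box-Tt : ∀ {φ} → (T ⦂ □ₛ φ) ∈ Γ ⊎ (t ⦂ □ₛ φ) ∈ Γ → (T ⦂ φ) ∈ Γ
    box-Ff : ∀ {φ} → (F ⦂ □ₛ φ) ∈ Γ ⊎ (f ⦂ □ₛ φ) ∈ Γ →
             ∃! _≡_ λ L → L ∈ (｛ t ｝ ∪ ｛ f ｝ ∪ ｛ F ｝) × (L ⦂ φ) ∈ Γ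

    imp-T : ∀ {φ ψ} → (T ⦂ φ ⇒ₛ ψ) ∈ Γ →
              (F ⦂ φ) ∈ Γ
            ⊎ (T ⦂ ψ) ∈ Γ
            ⊎ ((t ⦂ φ) ∈ Γ × (t ⦂ ψ) ∈ Γ)
            ⊎ ((f ⦂ φ) ∈ Γ × (t ⦂ ψ) ∈ Γ)
            ⊎ ((f ⦂ φ) ∈ Γ × (f ⦂ ψ) ∈ Γ)
    imp-t : ∀ {φ ψ} → (t ⦂ φ ⇒ₛ ψ) ∈ Γ →
              ((T ⦂ φ) ∈ Γ × (t ⦂ ψ) ∈ Γ)
            ⊎ ((t ⦂ φ) ∈ Γ × (t ⦂ ψ) ∈ Γ)
            ⊎ ((f ⦂ φ) ∈ Γ × (t ⦂ ψ) ∈ Γ)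
            ⊎ ((f ⦂ φ) ∈ Γ × (f ⦂ ψ) ∈ Γ)
    imp-f : ∀ {φ ψ} → (f ⦂ φ ⇒ₛ ψ) ∈ Γ →
              ((T ⦂ φ) ∈ Γ × (f ⦂ ψ) ∈ Γ)
            ⊎ ((t ⦂ φ) ∈ Γ × (f ⦂ ψ) ∈ Γ)
            ⊎ ((t ⦂ φ) ∈ Γ × (F ⦂ ψ) ∈ Γ)
    imp-F : ∀ {φ ψ} → (F ⦂ φ ⇒ₛ ψ) ∈ Γ → (T ⦂ φ) ∈ Γ × (F ⦂ ψ) ∈ Γ

    all-T : ∀ (φ : Matrix Θ) → (T ⦂ ∀ₛ φ) ∈ Γ → ∀ c → (T ⦂ φ ⦅ c ⦆) ∈ Γ
    all-t : ∀ (φ : Matrix Θ) → (t ⦂ ∀ₛ φ) ∈ Γ →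
            ∃ λ c → (t ⦂ φ ⦅ c ⦆) ∈ Γ ×
              (∀ c′ → c′ ≢ c → (T ⦂ φ ⦅ c′ ⦆) ∈ Γ ⊎ (t ⦂ φ ⦅ c′ ⦆) ∈ Γ)
    all-f : ∀ (φ : Matrix Θ) → (f ⦂ ∀ₛ φ) ∈ Γ →
            ∃ λ c → (f ⦂ φ ⦅ c ⦆) ∈ Γ ×
              (∀ c′ → c′ ≢ c →
                 ((T ⦂ φ ⦅ c′ ⦆) ∈ Γ ⊎ (t ⦂ φ ⦅ c′ ⦆) ∈ Γ ⊎ (f ⦂ φ ⦅ c′ ⦆) ∈ Γ)
                 × (F ⦂ φ ⦅ c′ ⦆) ∉ Γ)
    all-F : ∀ (φ : Matrix Θ) → (F ⦂ ∀ₛ φ) ∈ Γ → ∃ λ c → (F ⦂ φ ⦅ c ⦆) ∈ Γ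

{-# OPTIONS --safe #-}

-- Give a sentence the label that Γ assigns to one of its variants, if there is
-- one, and otherwise compute a value from the values of its immediate
-- subformulas or instances.  This respects the multioperations because variants
-- can be inverted: once their void outer quantifiers are stripped, two variants
-- have the same main connective and their components are variants.  Stripping
-- stays inside Γ, since every label of ∀xφ in Γ is also the label of some
-- instance φ(c), and φ(c) = φ when x is not free in φ.

module Submission where

open import Defs
open import Level using (0ℓ)
open import Axiom.ExcludedMiddle using (ExcludedMiddle)
open import Data.Nat using (ℕ; zero; suc; _≤_; _<_; _⊔_; _≟_; z≤n; s≤s)
open import Data.Nat.Properties using (≤-refl; ≤-antisym; m≤m⊔n; m≤n⊔m; m⊔n≤o⇒m≤o; m⊔n≤o⇒n≤o)
open import Data.Product using (∃; _×_; _,_; proj₁; proj₂)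
open import Data.Sum using (_⊎_; inj₁; inj₂; [_,_]; [_,_]′)
open import Data.Vec using (Vec; []; _∷_; map)
open import Data.Vec.Properties using (map-id)
open import Data.Vec.Relation.Unary.Any using (here; there)
open import Data.Vec.Membership.Propositional using () renaming (_∈_ to _∈ᵥ_)
open import Function using (_∘_; id)
open import Function.Bundles using (_↔_; Inverse)
open import Function.Definitions using (StrictlySurjective)
open import Relation.Nullary using (¬_; yes; no; contradiction)
open import Relation.Unary using (Pred; _∈_; _∪_; ｛_｝)
open import Relation.Binary.PropositionalEquality
  using (_≡_; _≢_; refl; sym; trans; cong; cong₂; subst; subst₂; ≢-sym)

-- Substitution and variants

module _ {Θ : Signature} where

  substₜ-yes : ∀ x {τ : Term Θ} → var x [ x / τ ]ₜ ≡ τ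
  substₜ-yes x with x ≟ x
  ... | yes _  = refl
  ... | no x≢x = contradiction refl x≢x

  substₜ-no : ∀ {x y} {τ : Term Θ} → x ≢ y → var y [ x / τ ]ₜ ≡ var y
  substₜ-no {x} {y} x≢y with x ≟ y
  ... | yes x≡y = contradiction x≡y x≢y
  ... | no _    = refl

  subst-∀-yes : ∀ x φ {τ : Term Θ} → (∀′ x φ) [ x / τ ] ≡ ∀′ x φ
  subst-∀-yes x φ with x ≟ x
  ... | yes _  = refl
  ... | no x≢x = contradiction refl x≢x

  subst-∀-no : ∀ {x y} φ {τ : Term Θ} → x ≢ y →
               (∀′ y φ) [ x / τ ] ≡ ∀′ y (φ [ x / τ ])
  subst-∀-no {x} {y} φ x≢y with x ≟ y
  ... | yes x≡y = contradiction x≡y x≢y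
  ... | no _    = refl

  FV⇒OccursIn : ∀ {x} (φ : Formula Θ) → x ∈FV φ → x OccursIn φ
  FV⇒OccursIn (atom P τs) p        = p
  FV⇒OccursIn (¬′ φ)      p        = FV⇒OccursIn φ p
  FV⇒OccursIn (□ φ)       p        = FV⇒OccursIn φ p
  FV⇒OccursIn (φ ⇒ ψ)     (inj₁ p) = inj₁ (FV⇒OccursIn φ p)
  FV⇒OccursIn (φ ⇒ ψ)     (inj₂ p) = inj₂ (FV⇒OccursIn ψ p)
  FV⇒OccursIn (∀′ y φ)    (_ , p)  = inj₂ (FV⇒OccursIn φ p)

  substs-void : ∀ {n x τ} (τs : Vec (Term Θ) n) → ¬ (var x ∈ᵥ τs) →
                map (_[ x / τ ]ₜ) τs ≡ τs
  substs-void []           _ = refl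
  substs-void (con c ∷ τs) p = cong (con c ∷_) (substs-void τs (p ∘ there))
  substs-void {x = x} (var y ∷ τs) p =
    cong₂ _∷_ (substₜ-no {x} λ { refl → p (here refl) }) (substs-void τs (p ∘ there))

  subst-void : ∀ {x τ} (φ : Formula Θ) → ¬ (x ∈FV φ) → φ [ x / τ ] ≡ φ
  subst-void (atom P τs) p = cong (atom P) (substs-void τs p)
  subst-void (¬′ φ)      p = cong ¬′_ (subst-void φ p)
  subst-void (□ φ)       p = cong □_ (subst-void φ p)
  subst-void (φ ⇒ ψ)     p = cong₂ _⇒_ (subst-void φ (p ∘ inj₁)) (subst-void ψ (p ∘ inj₂))
  subst-void {x} (∀′ y φ) p with x ≟ y
  ... | yes _  = refl
  ... | no x≢y = cong (∀′ y) (subst-void φ λ q → p (x≢y , q))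

  substs-rename : ∀ {n x y τ} (τs : Vec (Term Θ) n) → ¬ (var y ∈ᵥ τs) →
                  map (_[ y / τ ]ₜ) (map (_[ x / var y ]ₜ) τs) ≡ map (_[ x / τ ]ₜ) τs
  substs-rename []           _ = refl
  substs-rename (con c ∷ τs) p = cong (con c ∷_) (substs-rename τs (p ∘ there))
  substs-rename {x = x} {y} (var z ∷ τs) p with x ≟ z
  ... | yes _ = cong₂ _∷_ (substₜ-yes y) (substs-rename τs (p ∘ there))
  ... | no _  = cong₂ _∷_ (substₜ-no {y} λ { refl → p (here refl) })
                          (substs-rename τs (p ∘ there))

  -- Makes a formula and its renaming have literally equal instances. Freshness of `y` in all of `φ`
  -- prevents capture; under a quantifier on `x` itself the renaming stops, and the outer
  -- substitution then finds no free `y`.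
  subst-rename : ∀ {x y τ} (φ : Formula Θ) → ¬ (y OccursIn φ) →
                 φ [ x / var y ] [ y / τ ] ≡ φ [ x / τ ]
  subst-rename (atom P τs) p = cong (atom P) (substs-rename τs p)
  subst-rename (¬′ φ)      p = cong ¬′_ (subst-rename φ p)
  subst-rename (□ φ)       p = cong □_ (subst-rename φ p)
  subst-rename (φ ⇒ ψ)     p =
    cong₂ _⇒_ (subst-rename φ (p ∘ inj₁)) (subst-rename ψ (p ∘ inj₂))
  subst-rename {x} (∀′ z φ) p with x ≟ z
  ... | yes _ = subst-void (∀′ z φ) (p ∘ FV⇒OccursIn (∀′ z φ))
  ... | no _  = trans (subst-∀-no _ (p ∘ inj₁))
                      (cong (∀′ z) (subst-rename φ (p ∘ inj₂)))

  substₜ-comm : ∀ {x y z c} (τ : Term Θ) → z ≢ x → z ≢ y →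
                τ [ x / var y ]ₜ [ z / con c ]ₜ ≡ τ [ z / con c ]ₜ [ x / var y ]ₜ
  substₜ-comm (con d) _ _ = refl
  substₜ-comm {x} {y} {z} (var w) z≢x z≢y with x ≟ w | z ≟ w
  ... | yes refl | yes refl = contradiction refl z≢x
  ... | yes refl | no _     = trans (substₜ-no z≢y) (sym (substₜ-yes x))
  ... | no _     | yes refl = substₜ-yes z
  ... | no x≢w   | no z≢w   = trans (substₜ-no z≢w) (sym (substₜ-no x≢w))

  subst-comm : ∀ {x y z c} (φ : Formula Θ) → z ≢ x → z ≢ y →
               φ [ x / var y ] [ z / con c ] ≡ φ [ z / con c ] [ x / var y ]
  subst-comm {x} {y} {z} {c} (atom P τs) z≢x z≢y = cong (atom P) (go τs)
    where
    go : ∀ {n} (τs : Vec (Term Θ) n) →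
         map (_[ z / con c ]ₜ) (map (_[ x / var y ]ₜ) τs) ≡
         map (_[ x / var y ]ₜ) (map (_[ z / con c ]ₜ) τs)
    go []       = refl
    go (τ ∷ τs) = cong₂ _∷_ (substₜ-comm τ z≢x z≢y) (go τs)
  subst-comm (¬′ φ)  z≢x z≢y = cong ¬′_ (subst-comm φ z≢x z≢y)
  subst-comm (□ φ)   z≢x z≢y = cong □_ (subst-comm φ z≢x z≢y)
  subst-comm (φ ⇒ ψ) z≢x z≢y = cong₂ _⇒_ (subst-comm φ z≢x z≢y) (subst-comm ψ z≢x z≢y)
  subst-comm {x} {y} {z} (∀′ w φ) z≢x z≢y with x ≟ w | z ≟ w
  ... | yes refl | yes refl = contradiction refl z≢x
  ... | yes refl | no z≢w   = trans (subst-∀-no φ z≢w) (sym (subst-∀-yes x _))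
  ... | no x≢w   | yes refl = trans (subst-∀-yes z _) (sym (subst-∀-no φ x≢w))
  ... | no x≢w   | no z≢w   =
    trans (subst-∀-no _ z≢w)
          (trans (cong (∀′ w) (subst-comm φ z≢x z≢y)) (sym (subst-∀-no _ x≢w)))

  OccursIn-subst : ∀ {x y c} (φ : Formula Θ) → y OccursIn φ [ x / con c ] → y OccursIn φ
  OccursIn-subst {x} {y} {c} (atom P τs) p = proj₂ (∈FV-subst (atom P τs) {x} {y} {c} p)
  OccursIn-subst (¬′ φ)  p        = OccursIn-subst φ p
  OccursIn-subst (□ φ)   p        = OccursIn-subst φ p
  OccursIn-subst (φ ⇒ ψ) (inj₁ p) = inj₁ (OccursIn-subst φ p)
  OccursIn-subst (φ ⇒ ψ) (inj₂ p) = inj₂ (OccursIn-subst ψ p)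
  OccursIn-subst {x} (∀′ z φ) p with x ≟ z | p
  ... | yes _ | q      = q
  ... | no _  | inj₁ q = inj₁ q
  ... | no _  | inj₂ q = inj₂ (OccursIn-subst φ q)

  ∈-rename⁻ : ∀ {n x y z} (τs : Vec (Term Θ) n) → var z ∈ᵥ map (_[ x / var y ]ₜ) τs →
              z ≡ y ⊎ (z ≢ x × var z ∈ᵥ τs)
  ∈-rename⁻ (con d ∷ τs) (there p) with ∈-rename⁻ τs p
  ... | inj₁ z≡y       = inj₁ z≡y
  ... | inj₂ (z≢x , q) = inj₂ (z≢x , there q)
  ∈-rename⁻ {x = x} (var w ∷ τs) (here p) with x ≟ w | p
  ... | yes _  | refl = inj₁ refl
  ... | no x≢w | refl = inj₂ (≢-sym x≢w , here refl)
  ∈-rename⁻ (var w ∷ τs) (there p) with ∈-rename⁻ τs p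
  ... | inj₁ z≡y       = inj₁ z≡y
  ... | inj₂ (z≢x , q) = inj₂ (z≢x , there q)

  FV-rename⁻ : ∀ {x y z} (φ : Formula Θ) → z ∈FV φ [ x / var y ] →
               z ≡ y ⊎ (z ≢ x × z ∈FV φ)
  FV-rename⁻ (atom P τs) p = ∈-rename⁻ τs p
  FV-rename⁻ (¬′ φ)      p = FV-rename⁻ φ p
  FV-rename⁻ (□ φ)       p = FV-rename⁻ φ p
  FV-rename⁻ (φ ⇒ ψ) (inj₁ p) with FV-rename⁻ φ p
  ... | inj₁ z≡y       = inj₁ z≡y
  ... | inj₂ (z≢x , q) = inj₂ (z≢x , inj₁ q)
  FV-rename⁻ (φ ⇒ ψ) (inj₂ p) with FV-rename⁻ ψ p
  ... | inj₁ z≡y       = inj₁ z≡y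
  ... | inj₂ (z≢x , q) = inj₂ (z≢x , inj₂ q)
  FV-rename⁻ {x} (∀′ w φ) p with x ≟ w
  FV-rename⁻ (∀′ w φ) (z≢w , p) | yes refl = inj₂ (z≢w , z≢w , p)
  FV-rename⁻ (∀′ w φ) (z≢w , p) | no _ with FV-rename⁻ φ p
  ... | inj₁ z≡y       = inj₁ z≡y
  ... | inj₂ (z≢x , q) = inj₂ (z≢x , z≢w , q)

  ∈-subst⁺ : ∀ {n x z τ} (τs : Vec (Term Θ) n) → z ≢ x → var z ∈ᵥ τs →
             var z ∈ᵥ map (_[ x / τ ]ₜ) τs
  ∈-subst⁺ (τ ∷ τs) z≢x (here refl) = here (sym (substₜ-no (≢-sym z≢x)))
  ∈-subst⁺ (τ ∷ τs) z≢x (there p)   = there (∈-subst⁺ τs z≢x p)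

  FV-subst⁺ : ∀ {x z τ} (φ : Formula Θ) → z ≢ x → z ∈FV φ → z ∈FV φ [ x / τ ]
  FV-subst⁺ (atom P τs) z≢x p        = ∈-subst⁺ τs z≢x p
  FV-subst⁺ (¬′ φ)      z≢x p        = FV-subst⁺ φ z≢x p
  FV-subst⁺ (□ φ)       z≢x p        = FV-subst⁺ φ z≢x p
  FV-subst⁺ (φ ⇒ ψ)     z≢x (inj₁ p) = inj₁ (FV-subst⁺ φ z≢x p)
  FV-subst⁺ (φ ⇒ ψ)     z≢x (inj₂ p) = inj₂ (FV-subst⁺ ψ z≢x p)
  FV-subst⁺ {x} (∀′ w φ) z≢x (z≢w , p) with x ≟ w
  ... | yes _ = z≢w , p
  ... | no _  = z≢w , FV-subst⁺ φ z≢x p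

  ∈-rename⁺ : ∀ {n x y} (τs : Vec (Term Θ) n) → var x ∈ᵥ τs →
              var y ∈ᵥ map (_[ x / var y ]ₜ) τs
  ∈-rename⁺ {x = x} (_ ∷ τs) (here refl) = here (sym (substₜ-yes x))
  ∈-rename⁺ (_ ∷ τs) (there p)           = there (∈-rename⁺ τs p)

  FV-rename⁺ : ∀ {x y} (φ : Formula Θ) → ¬ (y OccursIn φ) → x ∈FV φ →
               y ∈FV φ [ x / var y ]
  FV-rename⁺ (atom P τs) _   p        = ∈-rename⁺ τs p
  FV-rename⁺ (¬′ φ)      y∉φ p        = FV-rename⁺ φ y∉φ p
  FV-rename⁺ (□ φ)       y∉φ p        = FV-rename⁺ φ y∉φ p
  FV-rename⁺ (φ ⇒ ψ)     y∉φ (inj₁ p) = inj₁ (FV-rename⁺ φ (y∉φ ∘ inj₁) p)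
  FV-rename⁺ (φ ⇒ ψ)     y∉φ (inj₂ p) = inj₂ (FV-rename⁺ ψ (y∉φ ∘ inj₂) p)
  FV-rename⁺ {x} (∀′ w φ) y∉φ (x≢w , p) with x ≟ w
  ... | yes x≡w = contradiction x≡w x≢w
  ... | no _    = y∉φ ∘ inj₁ , FV-rename⁺ φ (y∉φ ∘ inj₂) p

  -- Ensures that congruence under a quantifier never pairs a void quantifier with a non-void one.
  ∼-FV : ∀ {φ ψ : Formula Θ} → φ ∼ ψ → ∀ z → (z ∈FV φ → z ∈FV ψ) × (z ∈FV ψ → z ∈FV φ)
  ∼-FV ∼-refl        z = id , id
  ∼-FV (∼-sym p)     z = proj₂ (∼-FV p z) , proj₁ (∼-FV p z)
  ∼-FV (∼-trans p q) z =
    proj₁ (∼-FV q z) ∘ proj₁ (∼-FV p z) , proj₂ (∼-FV p z) ∘ proj₂ (∼-FV q z)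
  ∼-FV (¬-cong p)    z = ∼-FV p z
  ∼-FV (□-cong p)    z = ∼-FV p z
  ∼-FV (⇒-cong p q)  z =
    [ inj₁ ∘ proj₁ (∼-FV p z) , inj₂ ∘ proj₁ (∼-FV q z) ] ,
    [ inj₁ ∘ proj₂ (∼-FV p z) , inj₂ ∘ proj₂ (∼-FV q z) ]
  ∼-FV (∀-cong p)    z =
    (λ (z≢x , q) → z≢x , proj₁ (∼-FV p z) q) ,
    (λ (z≢x , q) → z≢x , proj₂ (∼-FV p z) q)
  ∼-FV (void x∉φ)    z = proj₂ , λ p → (λ { refl → x∉φ p }) , p
  ∼-FV (rename {φ = φ} y∉φ) z =
    (λ (z≢x , p) → (λ { refl → y∉φ (FV⇒OccursIn φ p) }) , FV-subst⁺ φ z≢x p) ,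
    (λ (z≢y , p) → [ (λ z≡y → contradiction z≡y z≢y) , id ] (FV-rename⁻ φ p))

  ≡⇒∼ : {φ ψ : Formula Θ} → φ ≡ ψ → φ ∼ ψ
  ≡⇒∼ refl = ∼-refl

  -- A constant cannot be captured, so each generator of `∼` survives; only coincidences of `z` with
  -- a bound variable need care.
  ∼-subst : ∀ {φ ψ : Formula Θ} z c → φ ∼ ψ → φ [ z / con c ] ∼ ψ [ z / con c ]
  ∼-subst z c ∼-refl        = ∼-refl
  ∼-subst z c (∼-sym p)     = ∼-sym (∼-subst z c p)
  ∼-subst z c (∼-trans p q) = ∼-trans (∼-subst z c p) (∼-subst z c q)
  ∼-subst z c (¬-cong p)    = ¬-cong (∼-subst z c p)
  ∼-subst z c (□-cong p)    = □-cong (∼-subst z c p)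
  ∼-subst z c (⇒-cong p q)  = ⇒-cong (∼-subst z c p) (∼-subst z c q)
  ∼-subst z c (∀-cong {x} p) with z ≟ x
  ... | yes _ = ∀-cong p
  ... | no _  = ∀-cong (∼-subst z c p)
  ∼-subst z c (void {x} {φ} x∉φ) with z ≟ x
  ... | yes refl = ∼-trans (void x∉φ) (≡⇒∼ (sym (subst-void φ x∉φ)))
  ... | no _     = void (x∉φ ∘ proj₂ ∘ ∈FV-subst φ)
  ∼-subst z c (rename {x} {y} {φ} y∉φ) with z ≟ x | z ≟ y
  ... | yes refl | yes refl = rename y∉φ
  -- On the left the substitution is blocked by the quantifier; on the right it is void, since the
  -- renaming has removed every free `z`.
  ... | yes refl | no z≢y   =
    ∼-trans (rename y∉φ) (≡⇒∼ (cong (∀′ y) (sym (subst-void (φ [ z / var y ]) z∉))))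
    where
    z∉ : ¬ (z ∈FV φ [ z / var y ])
    z∉ p = [ z≢y , (λ (z≢z , _) → z≢z refl) ] (FV-rename⁻ φ p)
  -- Here the blocking is on the right, and on the left freshness of `y` makes the substitution
  -- void.
  ... | no _     | yes refl =
    ∼-trans (∀-cong (≡⇒∼ (subst-void φ (y∉φ ∘ FV⇒OccursIn φ)))) (rename y∉φ)
  ... | no z≢x   | no z≢y   =
    ∼-trans (rename (y∉φ ∘ OccursIn-subst φ))
            (≡⇒∼ (cong (∀′ y) (sym (subst-comm φ z≢x z≢y))))

  -- Height, and comparison of formulas by main connective

  height : Formula Θ → ℕ
  height (atom P τs) = 0
  height (¬′ φ)      = suc (height φ)
  height (□ φ)       = suc (height φ)
  height (φ ⇒ ψ)     = suc (height φ ⊔ height ψ)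
  height (∀′ x φ)    = suc (height φ)

  -- Terms do not count towards the height, so an instance lies strictly below the quantified
  -- formula, although it is not a subformula.
  height-subst : ∀ {x τ} (φ : Formula Θ) → height (φ [ x / τ ]) ≡ height φ
  height-subst (atom P τs) = refl
  height-subst (¬′ φ)      = cong suc (height-subst φ)
  height-subst (□ φ)       = cong suc (height-subst φ)
  height-subst (φ ⇒ ψ)     = cong suc (cong₂ _⊔_ (height-subst φ) (height-subst ψ))
  height-subst {x} (∀′ y φ) with x ≟ y
  ... | yes _ = refl
  ... | no _  = cong suc (height-subst φ)

  infix 4 _≃_

  -- The shape that inverting `∼` yields. Quantified formulas are compared through their constant
  -- instances instead of their bodies, because the bound variables may differ.
  data _≃_ : Formula Θ → Formula Θ → Set where
    atom≃ : ∀ {P τs} → atom P τs ≃ atom P τs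
    ¬≃    : ∀ {φ φ′} → φ ∼ φ′ → ¬′ φ ≃ ¬′ φ′
    □≃    : ∀ {φ φ′} → φ ∼ φ′ → □ φ ≃ □ φ′
    ⇒≃    : ∀ {φ φ′ ψ ψ′} → φ ∼ φ′ → ψ ∼ ψ′ → φ ⇒ ψ ≃ φ′ ⇒ ψ′
    ∀≃    : ∀ {x x′ φ φ′} → (∀ c → φ [ x / con c ] ∼ φ′ [ x′ / con c ]) →
            ∀′ x φ ≃ ∀′ x′ φ′

  ≃-refl : ∀ {φ} → φ ≃ φ
  ≃-refl {atom P τs} = atom≃
  ≃-refl {¬′ φ}      = ¬≃ ∼-refl
  ≃-refl {□ φ}       = □≃ ∼-refl
  ≃-refl {φ ⇒ ψ}     = ⇒≃ ∼-refl ∼-refl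
  ≃-refl {∀′ x φ}    = ∀≃ λ _ → ∼-refl

  ≃-sym : ∀ {φ ψ} → φ ≃ ψ → ψ ≃ φ
  ≃-sym atom≃    = atom≃
  ≃-sym (¬≃ p)   = ¬≃ (∼-sym p)
  ≃-sym (□≃ p)   = □≃ (∼-sym p)
  ≃-sym (⇒≃ p q) = ⇒≃ (∼-sym p) (∼-sym q)
  ≃-sym (∀≃ p)   = ∀≃ λ c → ∼-sym (p c)

  ≃-trans : ∀ {φ ψ χ} → φ ≃ ψ → ψ ≃ χ → φ ≃ χ
  ≃-trans atom≃    atom≃      = atom≃
  ≃-trans (¬≃ p)   (¬≃ q)     = ¬≃ (∼-trans p q)
  ≃-trans (□≃ p)   (□≃ q)     = □≃ (∼-trans p q)
  ≃-trans (⇒≃ p q) (⇒≃ p′ q′) = ⇒≃ (∼-trans p p′) (∼-trans q q′)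
  ≃-trans (∀≃ p)   (∀≃ q)     = ∀≃ λ c → ∼-trans (p c) (q c)

-- Truth values

rank-injective : ∀ a b → rank a ≡ rank b → a ≡ b
rank-injective T T _ = refl
rank-injective t t _ = refl
rank-injective f f _ = refl
rank-injective F F _ = refl

neg-involutive : ∀ a → neg (neg a) ≡ a
neg-involutive T = refl
neg-involutive t = refl
neg-involutive f = refl
neg-involutive F = refl

box : Value → Value
box T = T
box _ = f

box-∈ : ∀ a → box a ∈ □̃₁ a
box-∈ T = inj₁ refl
box-∈ t = inj₁ refl
box-∈ f = inj₁ refl
box-∈ F = inj₁ refl

imp : Value → Value → Value
imp F _ = T
imp T b = b
imp t T = T
imp t t = T
imp t f = f
imp t F = f
imp f T = T
imp f t = T
imp f f = T
imp f F = t

imp-∈ : ∀ a b → imp a b ∈ a ⇒̃ b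
imp-∈ T T = refl
imp-∈ T t = refl
imp-∈ T f = refl
imp-∈ T F = refl
imp-∈ t T = refl
imp-∈ t t = inj₁ refl
imp-∈ t f = refl
imp-∈ t F = refl
imp-∈ f T = refl
imp-∈ f t = inj₁ refl
imp-∈ f f = inj₁ refl
imp-∈ f F = refl
imp-∈ F T = refl
imp-∈ F t = refl
imp-∈ F f = refl
imp-∈ F F = refl

F-⇒̃ : ∀ b → T ∈ F ⇒̃ b
F-⇒̃ T = refl
F-⇒̃ t = refl
F-⇒̃ f = refl
F-⇒̃ F = refl

⇒̃-T : ∀ a → T ∈ a ⇒̃ T
⇒̃-T T = refl
⇒̃-T t = refl
⇒̃-T f = refl
⇒̃-T F = refl

≤ᵥ-T : ∀ a → a ≤ᵥ T
≤ᵥ-T T = s≤s (s≤s (s≤s z≤n))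
≤ᵥ-T t = s≤s (s≤s z≤n)
≤ᵥ-T f = s≤s z≤n
≤ᵥ-T F = z≤n

t≤T : t ≤ᵥ T
t≤T = ≤ᵥ-T t

f≤t : f ≤ᵥ t
f≤t = s≤s z≤n

∀̃ᵈ₄-unique : ∀ {X a b} → a ∈ ∀̃ᵈ₄ X → b ∈ ∀̃ᵈ₄ X → a ≡ b
∀̃ᵈ₄-unique (a∈X , a≤) (b∈X , b≤) = rank-injective _ _ (≤-antisym (a≤ _ b∈X) (b≤ _ a∈X))

-- Minima and the stripping of void quantifiers

module Classical (em : ExcludedMiddle 0ℓ) where

  -- Membership is tested from `F` upwards; the given element is inspected only once `F`, `f` and
  -- `t` are excluded, and must then be `T`.
  minimum : (X : Pred Value 0ℓ) → ∃ X → ∃ (∀̃ᵈ₄ X)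
  minimum X x with em {X F}
  ... | yes p = F , p , λ _ _ → z≤n
  ... | no ¬F with em {X f}
  ... | yes p = f , p , λ { T _ → ≤ᵥ-T f ; t _ → f≤t ; f _ → ≤-refl ; F q → contradiction q ¬F }
  ... | no ¬f with em {X t}
  ... | yes p = t , p , λ { T _ → t≤T ; t _ → ≤-refl
                          ; f q → contradiction q ¬f ; F q → contradiction q ¬F }
  ... | no ¬t with x
  ... | T , p = T , p , λ { T _ → ≤-refl ; t q → contradiction q ¬t
                          ; f q → contradiction q ¬f ; F q → contradiction q ¬F }
  ... | t , p = contradiction p ¬t
  ... | f , p = contradiction p ¬f
  ... | F , p = contradiction p ¬F

  module _ {Θ : Signature} where

    core : Formula Θ → Formula Θ
    core (atom P τs) = atom P τs
    core (¬′ φ)      = ¬′ φ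
    core (□ φ)       = □ φ
    core (φ ⇒ ψ)     = φ ⇒ ψ
    core (∀′ x φ) with em {x ∈FV φ}
    ... | yes _ = ∀′ x φ
    ... | no _  = core φ

    core-void : ∀ {x} φ → ¬ (x ∈FV φ) → core (∀′ x φ) ≡ core φ
    core-void {x} φ x∉φ with em {x ∈FV φ}
    ... | yes x∈φ = contradiction x∈φ x∉φ
    ... | no _    = refl

    core-∀ : ∀ {x} φ → x ∈FV φ → core (∀′ x φ) ≡ ∀′ x φ
    core-∀ {x} φ x∈φ with em {x ∈FV φ}
    ... | yes _  = refl
    ... | no x∉φ = contradiction x∈φ x∉φ

    -- As `≃` is an equivalence, it suffices to check the generators. Void quantifiers vanish in the
    -- core, and by agreement of free variables the two quantifiers in `∀-cong` or `rename` are both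
    -- stripped or both kept.
    ∼⇒core-≃ : {φ ψ : Formula Θ} → φ ∼ ψ → core φ ≃ core ψ
    ∼⇒core-≃ ∼-refl        = ≃-refl
    ∼⇒core-≃ (∼-sym p)     = ≃-sym (∼⇒core-≃ p)
    ∼⇒core-≃ (∼-trans p q) = ≃-trans (∼⇒core-≃ p) (∼⇒core-≃ q)
    ∼⇒core-≃ (¬-cong p)    = ¬≃ p
    ∼⇒core-≃ (□-cong p)    = □≃ p
    ∼⇒core-≃ (⇒-cong p q)  = ⇒≃ p q
    ∼⇒core-≃ (∀-cong {x} {φ} {φ′} p) with em {x ∈FV φ} | em {x ∈FV φ′}
    ... | yes _   | yes _    = ∀≃ λ c → ∼-subst x c p
    ... | yes x∈φ | no x∉φ′  = contradiction (proj₁ (∼-FV p x) x∈φ) x∉φ′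
    ... | no x∉φ  | yes x∈φ′ = contradiction (proj₂ (∼-FV p x) x∈φ′) x∉φ
    ... | no _    | no _     = ∼⇒core-≃ p
    ∼⇒core-≃ (void {x} {φ} x∉φ) = subst (_≃ core φ) (sym (core-void φ x∉φ)) ≃-refl
    ∼⇒core-≃ (rename {x} {y} {φ} y∉φ) with em {x ∈FV φ} | em {y ∈FV φ [ x / var y ]}
    ... | yes _   | yes _  = ∀≃ λ c → ≡⇒∼ (sym (subst-rename φ y∉φ))
    ... | yes x∈φ | no y∉  = contradiction (FV-rename⁺ φ y∉φ x∈φ) y∉
    ... | no x∉φ  | yes y∈ =
      contradiction (subst (y ∈FV_) (subst-void φ x∉φ) y∈) (y∉φ ∘ FV⇒OccursIn φ)
    ... | no x∉φ  | no _   = subst (λ χ → core φ ≃ core χ) (sym (subst-void φ x∉φ)) ≃-refl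

  -- Labels that `Γ` gives to variants

  module Extension {Θ : Signature} (c₀ : Constant Θ)
                   (Γ : Pred (SignedFormula Θ) 0ℓ) (H : HintikkaSet Γ) where

    open HintikkaSet H

    Hit : Value → Formula Θ → Set
    Hit L φ = ∃ λ s → formula s ∼ φ × (L ⦂ s) ∈ Γ

    -- Makes the label taken from `Γ` independent of the variant that carries it.
    Hit-unique : ∀ {L L′ φ ψ} → φ ∼ ψ → Hit L φ → Hit L′ ψ → L ≡ L′
    Hit-unique φ∼ψ (_ , p , ∈Γ) (_ , q , ∈Γ′) =
      variants ∈Γ ∈Γ′ (∼-trans p (∼-trans φ∼ψ (∼-sym q)))

    Hit-∼ : ∀ {L φ ψ} → φ ∼ ψ → Hit L φ → Hit L ψ
    Hit-∼ φ∼ψ (s , p , ∈Γ) = s , ∼-trans p φ∼ψ , ∈Γ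

    some-instance : ∀ {L} (φ : Matrix Θ) → (L ⦂ ∀ₛ φ) ∈ Γ → ∃ λ c → (L ⦂ φ ⦅ c ⦆) ∈ Γ
    some-instance {T} φ p = c₀ , all-T φ p c₀
    some-instance {t} φ p = let c , q , _ = all-t φ p in c , q
    some-instance {f} φ p = let c , q , _ = all-f φ p in c , q
    some-instance {F} φ p = all-F φ p

    -- A void quantifier is removed by passing to an instance with the same label. That instance
    -- equals the body only propositionally; keeping `φ` and `ψ` apart lets the recursion be
    -- structural on `ψ`.
    core-∈Γ : ∀ {L} φ ψ .p → φ ≡ ψ → (L ⦂ sentence φ p) ∈ Γ →
              ∃ λ s → formula s ≡ core ψ × (L ⦂ s) ∈ Γ
    core-∈Γ _ (atom P τs) p refl ∈Γ = _ , refl , ∈Γ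
    core-∈Γ _ (¬′ φ)      p refl ∈Γ = _ , refl , ∈Γ
    core-∈Γ _ (□ φ)       p refl ∈Γ = _ , refl , ∈Γ
    core-∈Γ _ (φ ⇒ ψ)     p refl ∈Γ = _ , refl , ∈Γ
    core-∈Γ _ (∀′ x φ)    p refl ∈Γ with em {x ∈FV φ}
    ... | yes _  = _ , refl , ∈Γ
    ... | no x∉φ = let c , q = some-instance (matrix x φ p) ∈Γ in
      core-∈Γ (φ [ x / con c ]) φ (closed-instance x φ p c) (subst-void φ x∉φ) q

    -- Brings a labelled variant into the form to which the Hintikka clause for the main connective
    -- of `core φ` applies.
    Hit-core : ∀ {L φ} → Hit L φ → ∃ λ s → formula s ≃ core φ × (L ⦂ s) ∈ Γ
    Hit-core {φ = φ} (sentence ψ p , ψ∼φ , ∈Γ) =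
      let s , eq , ∈Γ′ = core-∈Γ ψ ψ p refl ∈Γ
      in  s , subst (_≃ core φ) (sym eq) (∼⇒core-≃ ψ∼φ) , ∈Γ′

    -- Minima over instances and recursive evaluation

    min : (Constant Θ → Value) → Value
    min g = proj₁ (minimum (λ a → ∃ λ c → g c ≡ a) (g c₀ , c₀ , refl))

    min-∈ : ∀ g → min g ∈ ∀̃ᵈ₄ (λ a → ∃ λ c → g c ≡ a)
    min-∈ g = proj₂ (minimum (λ a → ∃ λ c → g c ≡ a) (g c₀ , c₀ , refl))

    min-unique : ∀ {g a} → (∃ λ c → g c ≡ a) → (∀ c → a ≤ᵥ g c) → min g ≡ a
    min-unique {g} a∈ a≤ = ∀̃ᵈ₄-unique (min-∈ g) (a∈ , λ { _ (c , refl) → a≤ c })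

    min-cong : ∀ {g h} → (∀ c → g c ≡ h c) → min g ≡ min h
    min-cong {g} {h} eq =
      let (c , p) , q = min-∈ h
      in  min-unique (c , trans (eq c) p) λ d → q _ (d , sym (eq d))

    -- The first argument is fuel; any number above the height suffices.
    val : ℕ → Formula Θ → Value
    compute : ℕ → Formula Θ → Value

    -- A dummy value, never reached when the fuel exceeds the height.
    val zero    φ = T
    val (suc n) φ with em {∃ λ L → Hit L φ}
    ... | yes (L , _) = L
    ... | no _        = compute n φ

    -- An arbitrary choice for unlabelled atoms: the predicates of the structure will be read off
    -- the valuation.
    compute n (atom P τs) = T
    compute n (¬′ φ)      = neg (val n φ)
    compute n (□ φ)       = box (val n φ)
    compute n (φ ⇒ ψ)     = imp (val n φ) (val n ψ)
    compute n (∀′ x φ)    = min λ c → val n (φ [ x / con c ])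

    val-hit : ∀ {n L φ} → Hit L φ → val (suc n) φ ≡ L
    val-hit {φ = φ} h with em {∃ λ L → Hit L φ}
    ... | yes (_ , h′) = Hit-unique ∼-refl h′ h
    ... | no ¬h        = contradiction (_ , h) ¬h

    val-miss : ∀ {n φ} → ¬ (∃ λ L → Hit L φ) → val (suc n) φ ≡ compute n φ
    val-miss {φ = φ} ¬h with em {∃ λ L → Hit L φ}
    ... | yes h = contradiction h ¬h
    ... | no _  = refl

    -- Invariance of the evaluation under variants and fuel

    compute-void : ∀ n {x} φ → ¬ (x ∈FV φ) → compute n (∀′ x φ) ≡ val n φ
    compute-void n {x} φ x∉φ =
      min-unique (c₀ , eq c₀) λ c → subst (val n φ ≤ᵥ_) (sym (eq c)) ≤-refl
      where
      eq : ∀ c → val n (φ [ x / con c ]) ≡ val n φ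
      eq c = cong (val n) (subst-void φ x∉φ)

    -- Separates formulas with an outer void quantifier to peel off from those to which the
    -- inversion of `∼` applies directly.
    data View : Formula Θ → Set where
      void-∀ : ∀ {x φ} → ¬ (x ∈FV φ) → View (∀′ x φ)
      solid  : ∀ {φ} → core φ ≡ φ → View φ

    view : ∀ φ → View φ
    view (atom P τs) = solid refl
    view (¬′ φ)      = solid refl
    view (□ φ)       = solid refl
    view (φ ⇒ ψ)     = solid refl
    view (∀′ x φ) with em {x ∈FV φ}
    ... | yes x∈φ = solid (core-∀ φ x∈φ)
    ... | no x∉φ  = void-∀ x∉φ

    -- Variants may differ in height, hence two independent fuels; equal formulas give independence
    -- of fuel. Either both sides are hit with one label, or both are computed: void quantifiers are
    -- peeled off, each costing fuel on its own side, until `compute-≃` compares components.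
    val-∼ : ∀ n m {φ ψ} → height φ < n → height ψ < m → φ ∼ ψ → val n φ ≡ val m ψ
    compute-≃ : ∀ n m {φ ψ} → height φ ≤ n → height ψ ≤ m → φ ≃ ψ →
                compute n φ ≡ compute m ψ

    val-∼ (suc n) (suc m) {φ} {ψ} (s≤s hφ) (s≤s hψ) φ∼ψ with em {∃ λ L → Hit L φ}
    ... | yes (L , h) = sym (val-hit (Hit-∼ φ∼ψ h))
    ... | no ¬h = trans (go (view φ) (view ψ)) (sym (val-miss ¬h′))
      where
      ¬h′ : ¬ (∃ λ L → Hit L ψ)
      ¬h′ (L , h) = ¬h (L , Hit-∼ (∼-sym φ∼ψ) h)

      go : View φ → View ψ → compute n φ ≡ compute m ψ
      -- The body `φ′` is still a variant of `ψ`, and less fuel remains on the left.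
      go (void-∀ {x} {φ′} x∉φ) _ =
        trans (compute-void n φ′ x∉φ)
              (trans (val-∼ n (suc m) hφ (s≤s hψ) (∼-trans (∼-sym (void x∉φ)) φ∼ψ))
                     (val-miss ¬h′))
      go (solid _) (void-∀ {x} {ψ′} x∉ψ) =
        sym (trans (compute-void m ψ′ x∉ψ)
                   (trans (sym (val-∼ (suc n) m (s≤s hφ) hψ (∼-trans φ∼ψ (void x∉ψ))))
                          (val-miss ¬h)))
      go (solid p) (solid q) = compute-≃ n m hφ hψ (subst₂ _≃_ p q (∼⇒core-≃ φ∼ψ))

    compute-≃ n m hφ hψ atom≃ = refl
    compute-≃ n m hφ hψ (¬≃ p) = cong neg (val-∼ n m hφ hψ p)
    compute-≃ n m hφ hψ (□≃ p) = cong box (val-∼ n m hφ hψ p)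
    compute-≃ (suc n) (suc m) (s≤s h) (s≤s h′) (⇒≃ {φ} {φ′} p q) =
      cong₂ imp (val-∼ (suc n) (suc m) (s≤s (m⊔n≤o⇒m≤o (height φ) _ h))
                                       (s≤s (m⊔n≤o⇒m≤o (height φ′) _ h′)) p)
                (val-∼ (suc n) (suc m) (s≤s (m⊔n≤o⇒n≤o (height φ) _ h))
                                       (s≤s (m⊔n≤o⇒n≤o (height φ′) _ h′)) q)
    compute-≃ n m hφ hψ (∀≃ {φ = φ} {φ′} p) = min-cong λ c →
      val-∼ n m (subst (_< n) (sym (height-subst φ)) hφ)
                (subst (_< m) (sym (height-subst φ′)) hψ) (p c)

    -- The value satisfies the multioperations

    value : Formula Θ → Value
    value φ = val (suc (height φ)) φ

    value-∼ : ∀ {φ ψ} → φ ∼ ψ → value φ ≡ value ψ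
    value-∼ = val-∼ _ _ ≤-refl ≤-refl

    value-∈Γ : ∀ {L s φ} → (L ⦂ s) ∈ Γ → formula s ∼ φ → value φ ≡ L
    value-∈Γ ∈Γ p = val-hit (_ , p , ∈Γ)

    value-¬ : ∀ φ → value (¬′ φ) ≡ neg (value φ)
    value-¬ φ with em {∃ λ L → Hit L (¬′ φ)}
    ... | no _ = refl
    ... | yes (L , h) with Hit-core h
    ... | sentence (¬′ ψ) cl , ¬≃ p , ∈Γ =
      -- The Hintikka clause gives `φ` the value `neg L`, and a second negation returns `L`.
      sym (trans (cong neg (value-∈Γ (neg-L {φ = sentence ψ cl} ∈Γ) p)) (neg-involutive L))

    value-□ : ∀ φ → value (□ φ) ∈ □̃₁ (value φ)
    value-□ φ with em {∃ λ L → Hit L (□ φ)}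
    ... | no _ = box-∈ (value φ)
    ... | yes (L , h) with Hit-core h
    ... | sentence _ _ , □≃ p , ∈Γ = go L ∈Γ
      where
      -- All values other than `T` have the same image under `□̃₁`.
      f∨F : ∀ {L a} → L ∈ (｛ f ｝ ∪ ｛ F ｝) → a ∈ (｛ t ｝ ∪ ｛ f ｝ ∪ ｛ F ｝) → L ∈ □̃₁ a
      f∨F q (inj₁ refl)        = q
      f∨F q (inj₂ (inj₁ refl)) = q
      f∨F q (inj₂ (inj₂ refl)) = q

      go : ∀ L → (L ⦂ _) ∈ Γ → L ∈ □̃₁ (value φ)
      go T q = subst (λ a → T ∈ □̃₁ a) (sym (value-∈Γ (box-Tt (inj₁ q)) p)) (inj₁ refl)
      go t q = subst (λ a → t ∈ □̃₁ a) (sym (value-∈Γ (box-Tt (inj₂ q)) p)) (inj₂ refl)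
      go f q = let _ , (a∈ , r) , _ = box-Ff (inj₂ q) in
        subst (λ a → f ∈ □̃₁ a) (sym (value-∈Γ r p)) (f∨F (inj₁ refl) a∈)
      go F q = let _ , (a∈ , r) , _ = box-Ff (inj₁ q) in
        subst (λ a → F ∈ □̃₁ a) (sym (value-∈Γ r p)) (f∨F (inj₂ refl) a∈)

    value-⇒ : ∀ φ ψ → value (φ ⇒ ψ) ∈ value φ ⇒̃ value ψ
    value-⇒ φ ψ with em {∃ λ L → Hit L (φ ⇒ ψ)}
    -- Both components were evaluated with fuel for the larger one; fuel independence restores their
    -- own values.
    ... | no _ = subst (_∈ value φ ⇒̃ value ψ)
      (cong₂ imp (val-∼ _ _ ≤-refl (s≤s (m≤m⊔n _ _)) ∼-refl)
                 (val-∼ _ _ ≤-refl (s≤s (m≤n⊔m (height φ) _)) ∼-refl))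
      (imp-∈ (value φ) (value ψ))
    ... | yes (L , h) with Hit-core h
    ... | sentence (φ′ ⇒ ψ′) cl , ⇒≃ p q , ∈Γ = go L ∈Γ
      where
      φₛ ψₛ : Sentence Θ
      φₛ = sentence φ′ λ x → cl x ∘ inj₁
      ψₛ = sentence ψ′ λ x → cl x ∘ inj₂

      both : ∀ {L a b} → L ∈ a ⇒̃ b → (a ⦂ φₛ) ∈ Γ × (b ⦂ ψₛ) ∈ Γ → L ∈ value φ ⇒̃ value ψ
      both {L} L∈ (r , s) =
        subst₂ (λ a b → L ∈ a ⇒̃ b) (sym (value-∈Γ r p)) (sym (value-∈Γ s q)) L∈

      go : ∀ L → (L ⦂ φₛ ⇒ₛ ψₛ) ∈ Γ → L ∈ value φ ⇒̃ value ψ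
      -- The first two alternatives label one component only; this suffices because row `F` and
      -- column `T` of the table contain nothing but `T`.
      go T r = [ (λ s → subst (λ a → T ∈ a ⇒̃ value ψ) (sym (value-∈Γ s p)) (F-⇒̃ (value ψ)))
             , [ (λ s → subst (λ b → T ∈ value φ ⇒̃ b) (sym (value-∈Γ s q)) (⇒̃-T (value φ)))
             , [ both (inj₁ refl) , [ both (inj₁ refl) , both (inj₁ refl) ]′ ]′ ]′ ]′ (imp-T r)
      go t r = [ both refl , [ both (inj₂ refl) , [ both (inj₂ refl) , both (inj₂ refl) ]′ ]′ ]′
               (imp-t r)
      go f r = [ both refl , [ both refl , both refl ]′ ]′ (imp-f r)
      go F r = both refl (imp-F r)

    -- For a label from `Γ`, the Hintikka clauses show that it is attained at some instance and
    -- bounds every instance from below.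
    value-∀ : ∀ x φ → value (∀′ x φ) ≡ min (λ c → value (φ [ x / con c ]))
    value-∀ x φ with em {x ∈FV φ}
    ... | no x∉φ =
      sym (min-unique (c₀ , eq c₀) λ c → subst (value (∀′ x φ) ≤ᵥ_) (sym (eq c)) ≤-refl)
      where
      eq : ∀ c → value (φ [ x / con c ]) ≡ value (∀′ x φ)
      eq c = trans (cong value (subst-void φ x∉φ)) (value-∼ (∼-sym (void x∉φ)))
    ... | yes x∈φ with em {∃ λ L → Hit L (∀′ x φ)}
    ... | no _ = min-cong λ c →
      val-∼ _ _ (subst (λ h → suc h ≤ suc (height φ)) (sym (height-subst φ)) ≤-refl) ≤-refl ∼-refl
    ... | yes (L , h) with Hit-core h
    -- The quantifier is not void, so the core is the formula itself and `χ` must be universal, with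
    -- instances that are variants of those of `φ`.
    ... | sentence χ cl , χ≃ , ∈Γ with subst (χ ≃_) (core-∀ φ x∈φ) χ≃
    ... | ∀≃ {y} {φ = ψ} p = sym (go L ∈Γ)
      where
      M : Matrix Θ
      M = matrix y ψ cl

      at : ∀ {a} c → (a ⦂ M ⦅ c ⦆) ∈ Γ → value (φ [ x / con c ]) ≡ a
      at c q = value-∈Γ q (p c)

      below : ∀ a b c → (b ⦂ M ⦅ c ⦆) ∈ Γ → a ≤ᵥ b → a ≤ᵥ value (φ [ x / con c ])
      below a b c q = subst (a ≤ᵥ_) (sym (at c q))

      go : ∀ L → (L ⦂ ∀ₛ M) ∈ Γ → min (λ c → value (φ [ x / con c ])) ≡ L
      go T q = min-unique (c₀ , at c₀ (all-T M q c₀)) λ c → below T T c (all-T M q c) ≤-refl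
      go t q with all-t M q
      ... | c , r , others = min-unique (c , at c r) bound
        where
        bound : ∀ c′ → t ≤ᵥ value (φ [ x / con c′ ])
        -- The clause bounds only the constants other than the witness `c`, which is covered by its
        -- own label.
        bound c′ with em {c′ ≡ c}
        ... | yes refl = below t t c r ≤-refl
        ... | no c′≢c  = [ (λ s → below t T c′ s t≤T) , (λ s → below t t c′ s ≤-refl) ]′ (others c′ c′≢c)
      go f q with all-f M q
      ... | c , r , others = min-unique (c , at c r) bound
        where
        bound : ∀ c′ → f ≤ᵥ value (φ [ x / con c′ ])
        bound c′ with em {c′ ≡ c}
        ... | yes refl = below f f c r ≤-refl
        ... | no c′≢c  =
          [ (λ s → below f T c′ s (≤ᵥ-T f))
          , [ (λ s → below f t c′ s f≤t) , (λ s → below f f c′ s ≤-refl) ]′ ]′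
          (proj₁ (others c′ c′≢c))
      go F q = let c , r = all-F M q in min-unique (c , at c r) λ _ → z≤n

    -- The term structure and its valuation

    v : Sentence Θ → Value
    v = value ∘ formula

    -- Every constant denotes itself, and predicates are read off `v`, so that labelled and
    -- unlabelled atoms agree with it alike.
    𝔄 : Structure Θ
    𝔄 = record
      { U          = Constant Θ
      ; inhabitant = c₀
      ; predᴬ      = λ P cs → v (atomₛ P cs)
      ; conᴬ       = id
      }

    v-valuation : IsTm*Valuation 𝔄 v
    v-valuation = record
      { v-atom = λ P cs → cong (v ∘ atomₛ P) (sym (map-id cs))
      ; v-¬    = λ φ → sym (value-¬ (formula φ))
      ; v-□    = λ φ → value-□ (formula φ)
      ; v-⇒    = λ φ ψ → value-⇒ (formula φ) (formula ψ)
      ; v-∀    = λ { (matrix x φ _) → subst (_∈ ∀̃ᵈ₄ (λ a → ∃ λ c → value (φ [ x / con c ]) ≡ a))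
                                          (sym (value-∀ x φ)) (min-∈ _) }
      ; v-∼    = λ _ _ → value-∼
      }

mainTheorem3 : ExcludedMiddle 0ℓ →
    (Θ : Signature) (C̄ : Set) → C̄ ↔ ℕ →
    (Γ : Pred (SignedFormula (Θ ⟨ C̄ ⟩)) 0ℓ) → HintikkaSet Γ →
    ∃ λ (𝔄 : Structure (Θ ⟨ C̄ ⟩)) →
    StrictlySurjective _≡_ (Structure.conᴬ 𝔄) ×
    (∃ λ (v : Sentence (Θ ⟨ C̄ ⟩) → Value) →
    IsTm*Valuation 𝔄 v ×
    (∀ L φ → (L ⦂ φ) ∈ Γ → v φ ≡ L))
mainTheorem3 em Θ C̄ C̄↔ℕ Γ H =
  𝔄 , (λ c → c , refl) , v , v-valuation , λ _ _ ∈Γ → value-∈Γ ∈Γ ∼-refl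
  -- The new constant numbered 0 serves as `c₀`: it inhabits the universe and makes the sets of
  -- instance values nonempty.
  where open Classical.Extension em (inj₂ (Inverse.from C̄↔ℕ 0)) Γ H
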